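{- Let $X$ be an $m$-semiregular semi-equivelar toroidal map and let $Y$ be a $k$-semiregular cover of $X$. Then there exists a $k$-semiregular covering map $\eta\colon Z\to X$ such that $Z$ is minimal (i.e. $Z$ is a $k$-semiregular cover of $X$ whose number of sheets over $X$ is smallest among all $k$-semiregular covers of $X$).
   Context: A map is an embedding of a graph $G$ on a surface $S$ such that the closures of the components of $S\setminus G$ (the faces) are homeomorphic to $2$-discs. All maps are assumed polyhedral: the intersection of any two distinct faces is empty, a common vertex, or a common edge. A toroidal map is a map on the torus. The face-cycle of a vertex $u$ is the cyclically ordered sequence of faces incident to $u$. If it consists of $n_1$ consecutive $p_1$-gons, followed by $n_2$ consecutive $p_2$-gons, ..., followed by $n_k$ consecutive $p_k$-gons (with $p_i \ne p_{i+1}$, indices modulo $k$), then the vertex type of $u$ is $[p_1^{n_1},\dots,p_k^{n_k}]$. A map is semi-equivelar if all its vertices have the same vertex type. A flag is a mutually incident vertex-edge-face triple. ${\rm Aut}(X)$ is the group of automorphisms of $X$ (incidence-preserving self-bijections of the polyhedral complex taking vertices, edges, faces to vertices, edges, faces). A map $X$ is $k$-semiregular if ${\rm Aut}(X)$ has exactly $k$ orbits on the set of flags of $X$. A covering $\eta\colon Y\to X$ of maps is a surjective mapping which preserves adjacency and sends vertices, edges, faces of $Y$ to vertices, edges, faces of $X$ respectively, arising as the quotient of $Y$ by a group $\Gamma\le {\rm Aut}(Y)$ acting properly discontinuously, so that $X=Y/\Gamma$; then $Y$ is a cover of $X$. The covering is called $k$-semiregular if $Y$ is $k$-semiregular. The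 number of sheets is that of the topological covering. -}

module Defs where

open import Algebra.Bundles using (Group)
open import Data.Bool using (Bool; if_then_else_)
open import Data.Fin using (Fin; toℕ)
open import Data.List using (List; concat; replicate; tabulate)
open import Data.Nat using (ℕ; zero; suc; _+_; _≤_)
open import Data.Nat.DivMod using (_mod_)
open import Data.Product using (Σ-syntax; ∃-syntax; _×_; _,_)
open import Data.Sum using (_⊎_)
open import Function.Bundles using (_↔_; _⇔_; _↣_; mk⇔; Inverse; Equivalence)
open import Function.Construct.Composition using (_↔-∘_; _⇔-∘_)
open import Function.Construct.Identity using (↔-id; ⇔-id)
open import Function.Construct.Symmetry using (↔-sym; ⇔-sym)
open import Function.Definitions using (Injective; Surjective)
open import Level using (0ℓ)
open import Relation.Binary.Construct.Closure.ReflexiveTransitive using (Star)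
open import Relation.Binary.Definitions using (_Respects_)
open import Relation.Binary.PropositionalEquality
  using (_≡_; _≢_; refl; sym; trans; cong; subst₂)
open import Relation.Nullary using (¬_)
open import Relation.Unary using (Pred)

-- Cyclic successor.
next : ∀ {n} → Fin n → Fin n
next {suc n} i = suc (toℕ i) mod suc n

------------------------------------------------------------------------
-- Maps
--
-- A map is given by its cells and their incidences.  The conditions of
-- `Map` say exactly that gluing a disc along the boundary cycle of each
-- face produces a connected surface in which the closed faces are discs.

record Complex : Set₁ where
  infix 4 _on_ _bounds_
  field
    Vertex Edge Face : Set
    _on_             : Vertex → Edge → Set
    _bounds_         : Edge → Face → Set

  -- In a closed disc face, every vertex is an end of a boundary edge.
  infix 4 _of_
  _of_ : Vertex → Face → Set
  v of f = ∃[ e ] v on e × e bounds f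

  _∼_ : Vertex → Vertex → Set
  u ∼ v = ∃[ e ] u on e × v on e

  -- The face f is a polygon: `side i` joins `corner i` to
  -- `corner (next i)`, and the corners are pairwise distinct.
  record Boundary (f : Face) : Set where
    field
      size       : ℕ
      3≤size     : 3 ≤ size
      corner     : Fin size → Vertex
      side       : Fin size → Edge
      corner-inj : Injective _≡_ _≡_ corner
      side-ends  : ∀ i v → v on side i ⇔ (v ≡ corner i ⊎ v ≡ corner (next i))
      sides      : ∀ e → e bounds f ⇔ (∃[ i ] side i ≡ e)

  -- The edges and faces at u alternate in a single cycle: the edges at u
  -- that bound `sector i` are `spoke i` and `spoke (next i)`.  An
  -- enumeration may begin at any face and run in either direction.
  record FaceCycle (u : Vertex) : Set where
    field
      degree       : ℕ
      3≤degree     : 3 ≤ degree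
      spoke        : Fin degree → Edge
      sector       : Fin degree → Face
      spoke-inj    : Injective _≡_ _≡_ spoke
      sector-inj   : Injective _≡_ _≡_ sector
      spokes       : ∀ e → u on e ⇔ (∃[ i ] spoke i ≡ e)
      sectors      : ∀ f → u of f ⇔ (∃[ i ] sector i ≡ f)
      spoke-sector : ∀ i j → spoke j bounds sector i ⇔ (j ≡ i ⊎ j ≡ next i)

  data Intersection (f g : Face) : Set where
    empty  : (∀ v → ¬ (v of f × v of g)) → Intersection f g
    vertex : ∀ u → u of f → u of g →
             (∀ v → v of f → v of g → v ≡ u) →
             (∀ e → ¬ (e bounds f × e bounds g)) → Intersection f g
    edge   : ∀ a → a bounds f → a bounds g →
             (∀ v → v of f → v of g → v on a) →
             (∀ e → e bounds f → e bounds g → e ≡ a) → Intersection f g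

record Map : Set₁ where
  field
    complex : Complex
  open Complex complex public
  field
    ends       : ∀ e → ∃[ u ] ∃[ v ] u ≢ v × (∀ w → w on e ⇔ (w ≡ u ⊎ w ≡ v))
    boundary   : ∀ f → Boundary f
    faceCycle  : ∀ u → FaceCycle u
    base       : Vertex
    connected  : ∀ u v → Star _∼_ u v
    polyhedral : ∀ f g → f ≢ g → Intersection f g

  faceSize : Face → ℕ
  faceSize f = Boundary.size (boundary f)

  faceSizes : ∀ {u} → FaceCycle u → List ℕ
  faceSizes c = tabulate (λ i → faceSize (FaceCycle.sector c i))

  record Flag : Set where
    field
      v   : Vertex
      e   : Edge
      f   : Face
      v-e : v on e
      e-f : e bounds f

------------------------------------------------------------------------
-- Toroidal maps: finitely many cells, an orientation, and Euler
-- characteristic 0.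

module _ (X : Map) where
  open Map X

  -- An orientation gives each face a direction around its boundary, such
  -- that two faces induce opposite directions on a common edge.
  -- `tail o f i` is the vertex at which `side i` begins, as directed by f.
  tail : (Face → Bool) → ∀ f → Fin (faceSize f) → Vertex
  tail o f i = if o f then corner i else corner (next i)
    where open Boundary (boundary f)

  Orientable : Set
  Orientable = Σ[ o ∈ (Face → Bool) ] (∀ f g i j → f ≢ g →
    Boundary.side (boundary f) i ≡ Boundary.side (boundary g) j →
    tail o f i ≢ tail o g j)

  -- By the classification of closed surfaces, these conditions say that
  -- the underlying surface is a torus.
  record Toroidal : Set where
    field
      #V #E #F   : ℕ
      vertices   : Vertex ↔ Fin #V
      edges      : Edge ↔ Fin #E
      faces      : Face ↔ Fin #F
      orientable : Orientable
      euler      : #V + #F ≡ #E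

------------------------------------------------------------------------
-- Vertex types

-- [p₁^n₁, …, p_k^n_k].  For k = 1 the condition p_i ≢ p_{i+1} is void.
record VertexType : Set where
  field
    k        : ℕ
    p n      : Fin k → ℕ
    n≥1      : ∀ i → 1 ≤ n i
    distinct : k ≢ 1 → ∀ i → p i ≢ p (next i)

  polygons : List ℕ
  polygons = concat (tabulate (λ i → replicate (n i) (p i)))

-- As `c` may be any enumeration of the face-cycle, this does not depend on
-- where a vertex type starts or on its direction.
HasVertexType : (X : Map) → Map.Vertex X → VertexType → Set
HasVertexType X u τ =
  Σ[ c ∈ Map.FaceCycle X u ] Map.faceSizes X c ≡ VertexType.polygons τ

SemiEquivelar : Map → Set
SemiEquivelar X = Σ[ τ ∈ VertexType ] (∀ u → HasVertexType X u τ)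

------------------------------------------------------------------------
-- Automorphisms

record Automorphism (X : Map) : Set where
  open Map X
  field
    onV : Vertex ↔ Vertex
    onE : Edge ↔ Edge
    onF : Face ↔ Face
  actV : Vertex → Vertex
  actV = Inverse.to onV
  actE : Edge → Edge
  actE = Inverse.to onE
  actF : Face → Face
  actF = Inverse.to onF
  field
    on-pres     : ∀ v e → v on e ⇔ actV v on actE e
    bounds-pres : ∀ e f → e bounds f ⇔ actE e bounds actF f

open Automorphism using (actV; actE; actF)

-- Aut(X); two automorphisms are equal when they agree on all cells.
Aut : Map → Group 0ℓ 0ℓ
Aut X = record
  { Carrier = Automorphism X
  ; _≈_     = λ g h → (∀ v → actV g v ≡ actV h v)
                    × (∀ e → actE g e ≡ actE h e)
                    × (∀ f → actF g f ≡ actF h f)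
  ; _∙_     = _∘_
  ; ε       = identity
  ; _⁻¹     = inverse
  ; isGroup = record
    { isMonoid = record
      { isSemigroup = record
        { isMagma = record
          { isEquivalence = record
            { refl  = (λ _ → refl) , (λ _ → refl) , (λ _ → refl)
            ; sym   = λ (a , b , c) →
                (λ v → sym (a v)) , (λ e → sym (b e)) , (λ f → sym (c f))
            ; trans = λ (a , b , c) (a′ , b′ , c′) →
                (λ v → trans (a v) (a′ v)) ,
                (λ e → trans (b e) (b′ e)) ,
                (λ f → trans (c f) (c′ f))
            }
          ; ∙-cong = λ {g} {g′} {h} {h′} (a , b , c) (a′ , b′ , c′) →
              (λ v → trans (cong (actV g) (a′ v)) (a (actV h′ v))) ,
              (λ e → trans (cong (actE g) (b′ e)) (b (actE h′ e))) ,
              (λ f → trans (cong (actF g) (c′ f)) (c (actF h′ f)))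
          }
        ; assoc = λ _ _ _ → (λ _ → refl) , (λ _ → refl) , (λ _ → refl)
        }
      ; identity = (λ _ → (λ _ → refl) , (λ _ → refl) , (λ _ → refl))
                 , (λ _ → (λ _ → refl) , (λ _ → refl) , (λ _ → refl))
      }
    ; inverse =
        (λ g → (λ v → Inverse.strictlyInverseʳ (onV g) v)
             , (λ e → Inverse.strictlyInverseʳ (onE g) e)
             , (λ f → Inverse.strictlyInverseʳ (onF g) f))
      , (λ g → (λ v → Inverse.strictlyInverseˡ (onV g) v)
             , (λ e → Inverse.strictlyInverseˡ (onE g) e)
             , (λ f → Inverse.strictlyInverseˡ (onF g) f))
    ; ⁻¹-cong = λ {g} {h} (a , b , c) →
        inv-cong (onV g) (onV h) a ,
        inv-cong (onE g) (onE h) b ,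
        inv-cong (onF g) (onF h) c
    }
  }
  where
  open Map X
  open Automorphism using (onV; onE; onF; on-pres; bounds-pres)

  inv-cong : {A : Set} (g h : A ↔ A) →
             (∀ x → Inverse.to g x ≡ Inverse.to h x) →
             ∀ y → Inverse.from g y ≡ Inverse.from h y
  inv-cong g h eq y = Inverse.inverseʳ g
    (trans (sym (Inverse.strictlyInverseˡ h y)) (sym (eq (Inverse.from h y))))

  identity : Automorphism X
  identity = record
    { onV = ↔-id _ ; onE = ↔-id _ ; onF = ↔-id _
    ; on-pres = λ _ _ → ⇔-id _ ; bounds-pres = λ _ _ → ⇔-id _ }

  infixr 9 _∘_
  _∘_ : Automorphism X → Automorphism X → Automorphism X
  g ∘ h = record
    { onV = onV g ↔-∘ onV h
    ; onE = onE g ↔-∘ onE h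
    ; onF = onF g ↔-∘ onF h
    ; on-pres = λ v e → on-pres g _ _ ⇔-∘ on-pres h v e
    ; bounds-pres = λ e f → bounds-pres g _ _ ⇔-∘ bounds-pres h e f }

  transport : {A B : Set} (R : A → B → Set) (g : A ↔ A) (h : B ↔ B) →
              (∀ a b → R a b ⇔ R (Inverse.to g a) (Inverse.to h b)) →
              ∀ a b → R a b ⇔ R (Inverse.from g a) (Inverse.from h b)
  transport R g h pres a b = mk⇔
    (λ r → Equivalence.from (pres _ _)
      (subst₂ R (sym (Inverse.strictlyInverseˡ g a))
                (sym (Inverse.strictlyInverseˡ h b)) r))
    (λ r → subst₂ R (Inverse.strictlyInverseˡ g a)
                    (Inverse.strictlyInverseˡ h b)
                    (Equivalence.to (pres _ _) r))

  inverse : Automorphism X → Automorphism X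
  inverse g = record
    { onV = ↔-sym (onV g) ; onE = ↔-sym (onE g) ; onF = ↔-sym (onF g)
    ; on-pres = transport _on_ (onV g) (onE g) (on-pres g)
    ; bounds-pres = transport _bounds_ (onE g) (onF g) (bounds-pres g) }

SameOrbit : (X : Map) → Map.Flag X → Map.Flag X → Set
SameOrbit X a b = Σ[ g ∈ Automorphism X ]
  actV g (v a) ≡ v b × actE g (e a) ≡ e b × actF g (f a) ≡ f b
  where open Map.Flag

-- Aut(X) has exactly k orbits on flags: `orbit` identifies the set of
-- orbits with Fin k.
record Semiregular (k : ℕ) (X : Map) : Set where
  open Map X using (Flag)
  field
    orbit     : Flag → Fin k
    all-occur : ∀ i → ∃[ a ] orbit a ≡ i
    orbits    : ∀ a b → orbit a ≡ orbit b ⇔ SameOrbit X a b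

------------------------------------------------------------------------
-- Coverings

record Subgroup (G : Group 0ℓ 0ℓ) : Set₁ where
  open Group G
  field
    Member : Pred Carrier 0ℓ
    resp   : Member Respects _≈_
    ε∈     : Member ε
    ∙∈     : ∀ {g h} → Member g → Member h → Member (g ∙ h)
    ⁻¹∈    : ∀ {g} → Member g → Member (g ⁻¹)

-- The quotient map η : Y → X = Y/Γ.  The cells of X are the Γ-orbits of
-- cells of Y, and two cells of X are incident iff some of their preimages
-- are.
record Covering (Y X : Map) : Set₁ where
  private
    module Y = Map Y
    module X = Map X
  open Group (Aut Y) using (_≈_; ε)
  field
    ηV : Y.Vertex → X.Vertex
    ηE : Y.Edge → X.Edge
    ηF : Y.Face → X.Face

    surjV : Surjective _≡_ _≡_ ηV
    surjE : Surjective _≡_ _≡_ ηE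
    surjF : Surjective _≡_ _≡_ ηF

    Γ : Subgroup (Aut Y)
  open Subgroup Γ public using (Member)
  field
    -- Γ acts properly discontinuously and freely on the surface, i.e. Y → Y/Γ
    -- is a topological covering: a homeomorphism preserving a closed cell
    -- has a fixed point in it, and the complex is locally finite, so this
    -- means that only the identity preserves a cell.
    freeV : ∀ g → Member g → ∀ v → actV g v ≡ v → g ≈ ε
    freeE : ∀ g → Member g → ∀ e → actE g e ≡ e → g ≈ ε
    freeF : ∀ g → Member g → ∀ f → actF g f ≡ f → g ≈ ε

    fibreV : ∀ v w → ηV v ≡ ηV w ⇔ (Σ[ g ∈ Automorphism Y ] Member g × actV g v ≡ w)
    fibreE : ∀ d e → ηE d ≡ ηE e ⇔ (Σ[ g ∈ Automorphism Y ] Member g × actE g d ≡ e)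
    fibreF : ∀ f h → ηF f ≡ ηF h ⇔ (Σ[ g ∈ Automorphism Y ] Member g × actF g f ≡ h)

    on-quot     : ∀ x a → x X.on a ⇔
                  (∃[ v ] ∃[ e ] v Y.on e × ηV v ≡ x × ηE e ≡ a)
    bounds-quot : ∀ a b → a X.bounds b ⇔
                  (∃[ e ] ∃[ f ] e Y.bounds f × ηE e ≡ a × ηF f ≡ b)

  Fibre : X.Vertex → Set
  Fibre x = ∃[ v ] ηV v ≡ x

-- The number of sheets of a covering is the cardinality, possibly infinite,
-- of its fibres; by connectedness it is the same at every vertex.
FewerOrEqualSheets : ∀ {Z W X} → Covering Z X → Covering W X → Set
FewerOrEqualSheets {X = X} η ζ =
  (x : Map.Vertex X) → Covering.Fibre η x ↣ Covering.Fibre ζ x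

MinimalSemiregular : ∀ k {Z X} → Covering Z X → Set₁
MinimalSemiregular k {Z} {X} η = Semiregular k Z ×
  (∀ W (ζ : Covering W X) → Semiregular k W → FewerOrEqualSheets η ζ)

{-# OPTIONS --safe #-}
-- A covering group Γ acts simply transitively on each fibre, so any two fibres
-- of a covering have the same cardinality and it suffices to compare the
-- fibres over one vertex.  If some k-semiregular cover has a finite fibre
-- there, one with the least number of sheets exists.  Otherwise all these
-- fibres are infinite, and Y itself is minimal: being connected and locally
-- finite, it has countably many vertices, and ℕ embeds in every infinite set.
module Submission where

open import Defs
open import Algebra.Bundles using (Group)
open import Axiom.ExcludedMiddle using (ExcludedMiddle)
open import Axiom.UniquenessOfIdentityProofs using (module Decidable⇒UIP)
open import Data.Bool using (Bool; true; false)
open import Data.Fin using (Fin; zero; suc; toℕ)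
open import Data.Fin.Properties using (toℕ-injective)
open import Data.Nat using (ℕ; zero; suc; _<_; _<′_; ≤′-refl; ≤′-step)
open import Data.Nat.Binary using (ℕᵇ; zero; 2[1+_]; 1+[2_])
  renaming (toℕ to ℕᵇ⇒ℕ)
open import Data.Nat.Binary.Properties using ()
  renaming (toℕ-injective to ℕᵇ⇒ℕ-injective)
open import Data.Nat.Induction using (<-rec)
open import Data.Nat.Properties
  using (≤⇒≤′; <-cmp; n<1+n; m<n⇒m<1+n)
open import Data.Product using (Σ-syntax; ∃-syntax; _×_; _,_; proj₁; proj₂)
open import Data.Sum using (inj₁; inj₂)
open import Data.Vec using (Vec; []; _∷_; lookup)
open import Data.Vec.Relation.Unary.All.Properties using (lookup⁻)
open import Data.Vec.Relation.Unary.Unique.Propositional using (Unique; []; _∷_)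
open import Data.Vec.Relation.Unary.Unique.Propositional.Properties
  using (lookup-injective)
open import Function.Base using (_∘_)
open import Function.Bundles using (_↣_; mk↣; Inverse; Equivalence)
open import Function.Construct.Composition using (_↣-∘_)
open import Level using (0ℓ; lift; lower) renaming (suc to lsuc)
open import Relation.Binary.Construct.Closure.ReflexiveTransitive using (Star; ε; _◅_)
open import Relation.Binary.Definitions using (tri<; tri≈; tri>)
open import Relation.Binary.PropositionalEquality
  using (_≡_; _≢_; refl; sym; trans; cong)
open import Relation.Nullary using (¬_; Dec; yes; no; contradiction)
import Relation.Nullary.Decidable as Dec

-- Elements of `ℕᵇ` serve as words in the two letters `1+[2_]` and `2[1+_]`, with `zero` as the
-- empty word. The letter `1+[2_]` marks the end of the block for n, so the rest `x` can be
-- recovered.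
unary : ℕ → ℕᵇ → ℕᵇ
unary zero    x = 1+[2 x ]
unary (suc n) x = 2[1+ unary n x ]

unary-injective : ∀ m n {x y} → unary m x ≡ unary n y → m ≡ n × x ≡ y
unary-injective zero    zero    refl = refl , refl
unary-injective (suc m) (suc n) eq   with unary-injective m n (2[1+]-inj eq)
  where
  2[1+]-inj : ∀ {x y} → 2[1+ x ] ≡ 2[1+ y ] → x ≡ y
  2[1+]-inj refl = refl
... | refl , x≡y = refl , x≡y

unary≢zero : ∀ n {x} → unary n x ≢ zero
unary≢zero zero    ()
unary≢zero (suc n) ()

bit : Bool → ℕᵇ → ℕᵇ
bit false = 1+[2_]
bit true  = 2[1+_]

bit-injective : ∀ b c {x y} → bit b x ≡ bit c y → b ≡ c × x ≡ y
bit-injective false false refl = refl , refl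
bit-injective true  true  refl = refl , refl

module _ (Y : Map) where
  open Map Y

  endIndex : ∀ e {w} → w on e → Bool
  endIndex e {w} w-e with Equivalence.to (proj₂ (proj₂ (proj₂ (ends e))) w) w-e
  ... | inj₁ _ = false
  ... | inj₂ _ = true

  -- Incidence proofs need not be unique, and the index may depend on the proof. Each value still
  -- names one end of `e`, so the two proofs can be arbitrary.
  endIndex-injective : ∀ e {w x} (w-e : w on e) (x-e : x on e) →
                       endIndex e w-e ≡ endIndex e x-e → w ≡ x
  endIndex-injective e {w} {x} w-e x-e eq
    with Equivalence.to (proj₂ (proj₂ (proj₂ (ends e))) w) w-e
       | Equivalence.to (proj₂ (proj₂ (proj₂ (ends e))) x) x-e
  ... | inj₁ p | inj₁ q = trans p (sym q)
  ... | inj₂ p | inj₂ q = trans p (sym q)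

  spokeIndex : ∀ u e → u on e → ℕ
  spokeIndex u e u-e =
    toℕ (proj₁ (Equivalence.to (FaceCycle.spokes (faceCycle u) e) u-e))

  spokeIndex-injective : ∀ u {d e} (u-d : u on d) (u-e : u on e) →
                         spokeIndex u d u-d ≡ spokeIndex u e u-e → d ≡ e
  spokeIndex-injective u {d} {e} u-d u-e eq
    with Equivalence.to (FaceCycle.spokes (faceCycle u) d) u-d
       | Equivalence.to (FaceCycle.spokes (faceCycle u) e) u-e
  ... | i , p | j , q with toℕ-injective eq
  ... | refl = trans (sym p) q

  -- A path is determined by its start and, at each step, the index of the edge in
  -- the face-cycle and the choice of an end; `unary` is a prefix code for the former.
  pathCode : ∀ {u v} → Star _∼_ u v → ℕᵇ
  pathCode ε = zero
  pathCode {u} ((e , u-e , w-e) ◅ p) =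
    unary (spokeIndex u e u-e) (bit (endIndex e w-e) (pathCode p))

  -- Both paths start at `u`, so their first spoke indices are read in the same face-cycle and give
  -- the same edge. The end bit then gives the same next vertex, where the induction continues.
  pathCode-injective : ∀ {u v w} (p : Star _∼_ u v) (q : Star _∼_ u w) →
                       pathCode p ≡ pathCode q → v ≡ w
  pathCode-injective ε ε _ = refl
  pathCode-injective {u} ε ((e , u-e , _) ◅ _) eq =
    contradiction (sym eq) (unary≢zero (spokeIndex u e u-e))
  pathCode-injective {u} ((e , u-e , _) ◅ _) ε eq =
    contradiction eq (unary≢zero (spokeIndex u e u-e))
  pathCode-injective {u} ((d , u-d , x-d) ◅ p) ((e , u-e , y-e) ◅ q) eq
    with unary-injective (spokeIndex u d u-d) (spokeIndex u e u-e) eq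
  ... | spoke≡ , eq′ with spokeIndex-injective u u-d u-e spoke≡
  ... | refl with bit-injective (endIndex d x-d) (endIndex d y-e) eq′
  ... | end≡ , eq″ with endIndex-injective d x-d y-e end≡
  ... | refl = pathCode-injective p q eq″

  vertices-countable : Vertex ↣ ℕ
  vertices-countable = mk↣ {to = λ v → ℕᵇ⇒ℕ (pathCode (connected base v))}
    (pathCode-injective (connected base _) (connected base _) ∘ ℕᵇ⇒ℕ-injective)

module _ (em : ExcludedMiddle 0ℓ) {A : Set} where

  -- If `xs` exhausted `A`, sending each element to one of its positions in `xs` would inject `A`
  -- into `Fin n`.
  fresh : ∀ {n} (xs : Vec A n) → ¬ (A ↣ Fin n) → ∃[ x ] ∀ i → x ≢ lookup xs i
  fresh xs A↣̸ with em {P = ∃[ x ] ∀ i → x ≢ lookup xs i}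
  ... | yes new = new
  ... | no ¬new = contradiction (mk↣ {to = proj₁ ∘ covered} λ {x} {y} eq →
          trans (proj₂ (covered x))
                (trans (cong (lookup xs) eq) (sym (proj₂ (covered y))))) A↣̸
    where
    covered : ∀ x → ∃[ i ] x ≡ lookup xs i
    covered x with em {P = ∃[ i ] x ≡ lookup xs i}
    ... | yes found = found
    ... | no ¬found = contradiction (x , λ i eq → ¬found (i , eq)) ¬new

  distinctElements : ∀ n → (∀ m → m < n → ¬ (A ↣ Fin m)) →
                     Σ[ xs ∈ Vec A n ] Unique xs
  distinctElements zero    _     = [] , []
  distinctElements (suc n) large
    with distinctElements n (λ m m<n → large m (m<n⇒m<1+n m<n))
  ... | xs , unique with fresh xs (large n (n<1+n n))
  ... | x , x∉ = x ∷ xs , lookup⁻ x∉ ∷ unique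

  -- In the finite case this turns minimality, which only denies that certain injections exist, into
  -- the injection that a comparison of sheets requires.
  Fin↣ : ∀ n → (∀ m → m < n → ¬ (A ↣ Fin m)) → Fin n ↣ A
  Fin↣ n large with distinctElements n large
  ... | xs , unique = mk↣ {to = lookup xs} (lookup-injective unique _ _)

  module _ (infinite : ∀ n → ¬ (A ↣ Fin n)) where

    sequence : ℕ → A
    initial  : ∀ n → Vec A n

    sequence n = proj₁ (fresh (initial n) (infinite n))

    initial zero    = []
    initial (suc n) = sequence n ∷ initial n

    -- The constructors of `_<′_` follow the growth of `initial`: a new term enters at the head, and
    -- each later term pushes it one place deeper.
    lookup-initial : ∀ {m n} → m <′ n → ∃[ i ] lookup (initial n) i ≡ sequence m
    lookup-initial ≤′-refl       = zero , refl
    lookup-initial (≤′-step m<n) with lookup-initial m<n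
    ... | i , eq = suc i , eq

    sequence-distinct : ∀ {m n} → m < n → sequence m ≢ sequence n
    sequence-distinct {m} {n} m<n eq with lookup-initial (≤⇒≤′ m<n)
    ... | i , eq′ = proj₂ (fresh (initial n) (infinite n)) i (sym (trans eq′ eq))

    sequence-injective : ∀ {m n} → sequence m ≡ sequence n → m ≡ n
    sequence-injective {m} {n} eq with <-cmp m n
    ... | tri< m<n _ _ = contradiction eq (sequence-distinct m<n)
    ... | tri≈ _ m≡n _ = m≡n
    ... | tri> _ _ n<m = contradiction (sym eq) (sequence-distinct n<m)

    ℕ↣ : ℕ ↣ A
    ℕ↣ = mk↣ sequence-injective

-- Strong induction on n, where excluded middle decides whether `P` holds somewhere below n. The
-- values of `P` lie in `Set₁` because `AtMost` quantifies over maps.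
least : ExcludedMiddle (lsuc 0ℓ) → (P : ℕ → Set₁) → ∀ n → P n →
        ∃[ m ] P m × (∀ l → l < m → ¬ P l)
least em P = <-rec _ step
  where
  Least : Set₁
  Least = ∃[ m ] P m × (∀ l → l < m → ¬ P l)

  step : ∀ n → (∀ {m} → m < n → P m → Least) → P n → Least
  step n rec Pn with em {P = ∃[ m ] m < n × P m}
  ... | yes (m , m<n , Pm) = rec m<n Pm
  ... | no  none           = n , Pn , λ l l<n Pl → none (l , l<n , Pl)

module _ (em : ExcludedMiddle 0ℓ) {Y X : Map} (η : Covering Y X) where
  open Covering η
  open Automorphism using (actV; onV)
  open Group (Aut Y) using (_∙_; _⁻¹)

  -- Hedberg's theorem: excluded middle makes equality of vertices of `X` decidable, hence its
  -- proofs unique.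
  fibre-≡ : ∀ {x} {p q : Fibre x} → proj₁ p ≡ proj₁ q → p ≡ q
  fibre-≡ {p = v , p} {q = .v , q} refl =
    cong (v ,_) (Decidable⇒UIP.≡-irrelevant (λ _ _ → em) p q)

  -- Sends g v₀ to g v₁ for g ∈ Γ, where v₀ and v₁ lie over x and y.
  fibre↣fibre : ∀ x y → Fibre x ↣ Fibre y
  fibre↣fibre x y = mk↣ {to = to} (λ {p} {q} eq → fibre-≡ (injective p q (cong proj₁ eq)))
    where
    v₀ = proj₁ (surjV x)
    v₁ = proj₁ (surjV y)

    mover : (p : Fibre x) → Σ[ g ∈ Automorphism Y ] Member g × actV g v₀ ≡ proj₁ p
    mover (v , v↦x) = Equivalence.to (fibreV v₀ v)
      (trans (proj₂ (surjV x) refl) (sym v↦x))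

    to : Fibre x → Fibre y
    to p with mover p
    ... | g , g∈Γ , _ = actV g v₁ ,
      trans (sym (Equivalence.from (fibreV v₁ _) (g , g∈Γ , refl)))
            (proj₂ (surjV y) refl)

    agree : ∀ g h → Member g → Member h →
            actV g v₁ ≡ actV h v₁ → actV g v₀ ≡ actV h v₀
    agree g h g∈Γ h∈Γ eq = trans
      (sym (Inverse.strictlyInverseˡ (onV h) _))
      (cong (actV h) (proj₁ h⁻¹g≈ε v₀))
      where
      -- `h ⁻¹ ∙ g` fixes `v₁`, so freeness makes it trivial, and `g` and `h` agree at `v₀` too.
      h⁻¹g≈ε = freeV (h ⁻¹ ∙ g) (Subgroup.∙∈ Γ {h ⁻¹} {g} (Subgroup.⁻¹∈ Γ {h} h∈Γ) g∈Γ) v₁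
        (trans (cong (Inverse.from (onV h)) eq)
               (Inverse.strictlyInverseʳ (onV h) v₁))

    injective : ∀ p q → proj₁ (to p) ≡ proj₁ (to q) → proj₁ p ≡ proj₁ q
    injective p q eq with mover p | mover q
    ... | g , g∈Γ , gv₀≡ | h , h∈Γ , hv₀≡ =
      trans (sym gv₀≡) (trans (agree g h g∈Γ h∈Γ eq) hv₀≡)

  fibre-countable : ∀ x → Fibre x ↣ ℕ
  fibre-countable x = vertices-countable Y ↣-∘ mk↣ {to = proj₁} fibre-≡

fewerOrEqualSheets : ExcludedMiddle 0ℓ → ∀ {Z W X} (η : Covering Z X) (ζ : Covering W X) →
                     ∀ x → Covering.Fibre η x ↣ Covering.Fibre ζ x →
                     FewerOrEqualSheets η ζ
fewerOrEqualSheets em η ζ x η↣ζ y =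
  fibre↣fibre em ζ x y ↣-∘ (η↣ζ ↣-∘ fibre↣fibre em η y x)

theorem1p9 : ExcludedMiddle (lsuc 0ℓ) →
    (m : ℕ) (X : Map) →
    Semiregular m X → SemiEquivelar X → Toroidal X →
    (k : ℕ) (Y : Map) → Covering Y X → Semiregular k Y →
    Σ[ Z ∈ Map ] Σ[ η ∈ Covering Z X ] MinimalSemiregular k η
theorem1p9 em _ X _ _ _ k Y η Y-semireg = minimal em
  where
  em₀ : ExcludedMiddle 0ℓ
  em₀ = Dec.map′ lower (lift {ℓ = lsuc 0ℓ}) em

  x : Map.Vertex X
  x = Map.base X

  -- Stated by an injection rather than an exact count, so that its failure supplies the hypotheses
  -- of `Fin↣` and `ℕ↣`.
  AtMost : ℕ → Set₁
  AtMost n = Σ[ Z ∈ Map ] Σ[ ζ ∈ Covering Z X ]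
    Semiregular k Z × (Covering.Fibre ζ x ↣ Fin n)

  minimal : Dec (∃[ n ] AtMost n) →
            Σ[ Z ∈ Map ] Σ[ ζ ∈ Covering Z X ] MinimalSemiregular k ζ
  minimal (yes (n , few)) with least em AtMost n few
  ... | l , (Z , ζ , Z-semireg , ζ↣l) , fewest =
    -- By `fewest`, the fibre of `W` injects into no `Fin j` with j < l, so it contains a copy of
    -- `Fin l`, in which the fibre of `Z` embeds.
    Z , ζ , Z-semireg , λ W ξ W-semireg → fewerOrEqualSheets em₀ ζ ξ x
      (Fin↣ em₀ l (λ j j<l ξ↣j → fewest j j<l (W , ξ , W-semireg , ξ↣j)) ↣-∘ ζ↣l)
  minimal (no infinite) =
    Y , η , Y-semireg , λ W ξ W-semireg → fewerOrEqualSheets em₀ η ξ x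
      (ℕ↣ em₀ (λ n ξ↣n → infinite (n , W , ξ , W-semireg , ξ↣n))
        ↣-∘ fibre-countable em₀ η x)
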